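{- Let $k\ge 2$ be an integer. Then $\mathrm{r}_{\binom{k}{2}}(12\cdots k)$ equals the number of pairs $(P,Q)$ of standard Young tableaux, both of staircase shape $(k-1,k-2,\dots,1)$, such that $P$ has increasing diagonals, i.e. for all $2\le r\le k-1$ and $1\le c\le k-2$ (whenever both cells exist), the entry of $P$ in row $r$, column $c$ is less than the entry of $P$ in row $r-1$, column $c+1$.
   Context: $\mathcal{S}_n$ is the set of permutations of $[n]$, $\pi^r=\pi_n\cdots\pi_1$ is the reversal of $\pi=\pi_1\cdots\pi_n$. A word $w=w_1\cdots w_m$ contains $\rho\in\mathcal{S}_k$ if there are indices $i_1<\cdots<i_k$ with $w_{i_a}\le w_{i_b}$ iff $\rho_a\le\rho_b$; otherwise it avoids $\rho$. $\mathcal{R}_n=\{\pi\pi^r:\pi\in\mathcal{S}_n\}$ (concatenation), $\mathcal{R}_n(\rho)$ is the set of its members avoiding $\rho$, and $\mathrm{r}_n(\rho)=|\mathcal{R}_n(\rho)|$. Tableaux are in English notation (rows indexed top to bottom, row 1 the longest). -}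

module Defs where

open import Data.Nat using (ℕ; zero; suc; _≤_; _<_; _∸_)
open import Data.Nat.Combinatorics using (_C_)
open import Data.Fin using (Fin; cast)
open import Data.List using (List; []; _∷_; _++_; reverse; map; upTo; downFrom; length; concat; lookup)
open import Data.List.Relation.Binary.Permutation.Propositional using (_↭_)
open import Data.List.Relation.Binary.Sublist.Propositional using (_⊆_)
open import Data.List.Relation.Unary.Unique.Propositional using (Unique)
open import Data.List.Membership.Propositional using (_∈_)
open import Data.Maybe using (Maybe; just; nothing)
open import Data.Product using (Σ; ∃; _×_; _,_)
open import Function.Bundles using (_⇔_)
open import Relation.Binary.PropositionalEquality using (_≡_)
open import Relation.Nullary using (¬_)

[_] : ℕ → List ℕ
[ n ] = map suc (upTo n)

IsPerm : ℕ → List ℕ → Set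
IsPerm n π = π ↭ [ n ]

InR : ℕ → List ℕ → Set
InR n w = ∃ λ π → IsPerm n π × w ≡ π ++ reverse π

OrderIso : List ℕ → List ℕ → Set
OrderIso s ρ = Σ (length s ≡ length ρ) λ eq →
  (a b : Fin (length s)) → (lookup s a ≤ lookup s b) ⇔ (lookup ρ (cast eq a) ≤ lookup ρ (cast eq b))

Contains : List ℕ → List ℕ → Set
Contains w ρ = ∃ λ s → s ⊆ w × OrderIso s ρ

Avoids : List ℕ → List ℕ → Set
Avoids w ρ = ¬ Contains w ρ

InRAvoid : ℕ → List ℕ → List ℕ → Set
InRAvoid n ρ w = InR n w × Avoids w ρ

HasSize : {A : Set} → (A → Set) → ℕ → Set
HasSize {A} P N = ∃ λ (L : List A) → Unique L × ((x : A) → (x ∈ L) ⇔ P x) × length L ≡ N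

-- Tableaux: list of rows (row 1 first), each a list of entries (column 1 first)
Tableau : Set
Tableau = List (List ℕ)

nth : {A : Set} → List A → ℕ → Maybe A
nth []       _       = nothing
nth (x ∷ xs) zero    = just x
nth (x ∷ xs) (suc i) = nth xs i

-- entry in row r, column c (1-indexed); nothing if the cell does not exist
entry : Tableau → ℕ → ℕ → Maybe ℕ
entry T zero    _       = nothing
entry T (suc r) zero    = nothing
entry T (suc r) (suc c) with nth T r
... | nothing  = nothing
... | just row = nth row c

staircase : ℕ → List ℕ
staircase k = map suc (downFrom (k ∸ 1))

IsSYT : List ℕ → Tableau → Set
IsSYT λs T =
  (map length T ≡ λs) ×
  (concat T ↭ [ length (concat T) ]) ×
  ((r c x y : ℕ) → entry T r c ≡ just x → entry T r (suc c) ≡ just y → x < y) ×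
  ((r c x y : ℕ) → entry T r c ≡ just x → entry T (suc r) c ≡ just y → x < y)

IncreasingDiagonals : ℕ → Tableau → Set
IncreasingDiagonals k P =
  (r c x y : ℕ) → 2 ≤ r → r ≤ k ∸ 1 → 1 ≤ c → c ≤ k ∸ 2 →
  entry P r c ≡ just x → entry P (r ∸ 1) (suc c) ≡ just y → x < y

GoodPair : ℕ → Tableau × Tableau → Set
GoodPair k (P , Q) = IsSYT (staircase k) P × IsSYT (staircase k) Q × IncreasingDiagonals k P

{-# OPTIONS --safe #-}
module Submission where

-- Label position i of π by the cell (b , a), where a + 1 and b + 1 are the lengths of the longest
-- increasing and decreasing subsequences of π ending at i. As in Erdős–Szekeres, distinct positions
-- get distinct labels. A subsequence of π πʳ increasing through π and then back through πʳ can turn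
-- at position i with length a + b + 1, so π πʳ avoids 12⋯k exactly when a + b + 1 < k throughout.
-- When n = k C 2 the labels are then in bijection with the cells of the staircase: writing the
-- positions in the cells gives Q, writing the values (with the columns reflected) gives P.
-- Conversely, the monotonicity of P and Q forces the coordinates of the cells of any such pair to
-- be these subsequence lengths.

open import Defs
open import Data.Nat using (ℕ; zero; suc; _+_; _∸_; _≤_; _<_; _<?_; z≤n; s≤s; s≤s⁻¹; _≤′_; ≤′-refl; ≤′-step)
open import Data.Nat.Properties
open import Data.Nat.Tactic.RingSolver using (solve-∀)
open import Data.Nat.Combinatorics using (_C_; nC1≡n; nCk+nC[k+1]≡[n+1]C[k+1])
open import Data.Fin as Fin using (Fin; toℕ; cast)
open import Data.Fin.Properties using (toℕ-cast; toℕ-injective)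
open import Data.List using (List; []; _∷_; _++_; map; concat; reverse; length; lookup; take; filter; deduplicate; upTo; downFrom; applyUpTo; cartesianProductWith)
open import Data.List.Properties using (reverse-downFrom; length-applyUpTo; length-map; length-upTo; map-∘; map-cong-local; length-++; map-upTo; tabulate-lookup; upTo-∷ʳ; map-++; reverse-upTo; reverse-map; length-take; ≡-dec; ∷-injectiveˡ; ∷-injectiveʳ)
open import Data.List.Membership.Propositional using (_∈_)
open import Data.List.Membership.Propositional.Properties using (∈-lookup; ∈-∃++; ∈-++⁻; ∈-++⁺ˡ; ∈-++⁺ʳ; ∈-map⁺; ∈-map⁻; ∈-upTo⁺; ∈-upTo⁻; ∈-downFrom⁻; ∈-filter⁺; ∈-filter⁻; ∈-deduplicate⁺; ∈-deduplicate⁻; ∈-cartesianProductWith⁺)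
open import Data.List.Relation.Binary.Permutation.Propositional using (_↭_; ↭-sym; ↭-trans; ↭-refl; ↭-reflexive; ↭-prep; ↭⇒↭ₛ)
open import Data.List.Relation.Binary.Permutation.Propositional.Properties using (↭-length; ∈-resp-↭; shift; map⁺)
open import Data.List.Relation.Binary.Sublist.Propositional using (_⊆_; []; _∷_; _∷ʳ_; ⊆-refl; ⊆-trans; minimum)
import Data.List.Relation.Binary.Permutation.Setoid.Properties as Permₛ
import Data.List.Relation.Binary.Sublist.Propositional.Properties as Sub
open import Data.List.Relation.Unary.All as All using (All; []; _∷_)
import Data.List.Relation.Unary.All.Properties as All
open import Data.List.Relation.Unary.AllPairs as AllPairs using (AllPairs; []; _∷_; allPairs?)
import Data.List.Relation.Unary.AllPairs.Properties as AllPairs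
open import Data.List.Relation.Unary.Any using (here; there; any?)
open import Data.List.Relation.Unary.Unique.Propositional using (Unique)
open import Data.List.Relation.Unary.Unique.Propositional.Properties using (upTo⁺; Unique[x∷xs]⇒x∉xs) renaming (map⁺ to Unique-map⁺)
open import Data.List.Relation.Unary.Unique.DecPropositional.Properties using (deduplicate-!)
open import Data.Maybe using (just; nothing; _>>=_)
open import Data.Product using (∃; ∃₂; _×_; _,_; proj₁; proj₂; uncurry)
open import Data.Empty using (⊥)
open import Data.Sum using (inj₁; inj₂)
open import Function using (_∘_; id)
open import Function.Bundles using (mk⇔; Equivalence)
open import Relation.Binary using (DecidableEquality; tri<; tri≈; tri>)
open import Relation.Binary.PropositionalEquality hiding ([_])
open import Relation.Nullary using (Dec; yes; no; ¬?; contradiction; _×-dec_; _⊎-dec_)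
open import Relation.Nullary.Decidable using (map′)
open import Relation.Unary using (Decidable)

-- Lists without repetition, and counting with them.

private
  variable
    A B : Set

Unique-resp-↭ : {xs ys : List A} → xs ↭ ys → Unique xs → Unique ys
Unique-resp-↭ = Permₛ.Unique-resp-↭ (setoid _) ∘ ↭⇒↭ₛ

Unique-map-injective : {f : A → B} {xs : List A} → Unique (map f xs) →
  ∀ {x y} → x ∈ xs → y ∈ xs → f x ≡ f y → x ≡ y
Unique-map-injective (_ ∷ _) (here refl) (here refl) _ = refl
Unique-map-injective {f = f} {_ ∷ xs} u@(_ ∷ _) (here refl) (there q) e =
  contradiction (subst (_∈ map f xs) (sym e) (∈-map⁺ f q)) (Unique[x∷xs]⇒x∉xs u)
Unique-map-injective {f = f} {_ ∷ xs} u@(_ ∷ _) (there p) (here refl) e =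
  contradiction (subst (_∈ map f xs) e (∈-map⁺ f p)) (Unique[x∷xs]⇒x∉xs u)
Unique-map-injective (_ ∷ u) (there p) (there q) e = Unique-map-injective u p q e

injective⇒Unique-map : {f : A → B} {xs : List A} →
  (∀ {x y} → x ∈ xs → y ∈ xs → f x ≡ f y → x ≡ y) → Unique xs → Unique (map f xs)
injective⇒Unique-map inj [] = []
injective⇒Unique-map {f = f} {x ∷ xs} inj u@(_ ∷ u′) =
  All.map⁺ (All.tabulate λ y∈ e → Unique[x∷xs]⇒x∉xs u (subst (_∈ xs) (sym (inj (here refl) (there y∈) e)) y∈))
  ∷ injective⇒Unique-map (λ p q → inj (there p) (there q)) u′

-- Deleting one occurrence of the head `x` from `ys` keeps the inclusion, as `x` does not recur in
-- `xs`; the length bound leaves nothing over.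
pigeonhole : {xs ys : List A} → Unique xs → (∀ {x} → x ∈ xs → x ∈ ys) →
  length ys ≤ length xs → xs ↭ ys
pigeonhole {ys = []} [] sub le = ↭-refl
pigeonhole {ys = _ ∷ _} [] sub ()
pigeonhole {xs = x ∷ xs} u@(_ ∷ u′) sub le with ∈-∃++ (sub (here refl))
... | ys₁ , ys₂ , refl = ↭-trans (↭-prep x (pigeonhole u′ sub′ le′)) (↭-sym σ)
  where
  σ = shift x ys₁ ys₂
  sub′ : ∀ {y} → y ∈ xs → y ∈ ys₁ ++ ys₂
  sub′ y∈ with ∈-resp-↭ σ (sub (there y∈))
  ... | here refl = contradiction y∈ (Unique[x∷xs]⇒x∉xs u)
  ... | there q = q
  le′ = s≤s⁻¹ (subst (_≤ suc (length xs)) (↭-length σ) le)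

choose : {D : A → Set} → Decidable D → {S : A → B → Set} → B →
  (∀ x → D x → ∃ (S x)) → ∃ λ (f : A → B) → ∀ x → D x → S x (f x)
choose {A = A} {B = B} {D} D? {S} b₀ H = (λ x → pick x (D? x)) , λ x → spec x (D? x)
  where
  pick : ∀ x → Dec (D x) → B
  pick x (yes d) = proj₁ (H x d)
  pick x (no _)  = b₀
  spec : ∀ x d? → D x → S x (pick x d?)
  spec x (yes d) _ = proj₂ (H x d)
  spec x (no ¬d) d = contradiction d ¬d

-- `HasSize` asks for an actual list, so finiteness must be effective. `L` may have repetitions and
-- elements outside `P`; the two passes remove them.
HasSize-decidable : {P : A → Set} → DecidableEquality A → Decidable P → (L : List A) →
  (∀ x → P x → x ∈ L) → ∃ (HasSize P)
HasSize-decidable {P = P} _≟′_ P? L complete = _ , L′ , deduplicate-! _≟′_ _ , (λ x → mk⇔ (to x) (from x)) , refl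
  where
  L′ = deduplicate _≟′_ (filter P? L)
  to : ∀ x → x ∈ L′ → P x
  to x x∈ = proj₂ (∈-filter⁻ P? {xs = L} (∈-deduplicate⁻ _≟′_ (filter P? L) x∈))
  from : ∀ x → P x → x ∈ L′
  from x px = ∈-deduplicate⁺ _≟′_ (∈-filter⁺ P? (complete x px) px)

-- A partner is picked for each element: `injective` keeps the partners distinct, and `surjective`
-- with `functional` shows that none is missed.
HasSize-transfer : {P : A → Set} {Q : B → Set} (R : A → B → Set) →
  (∀ {x} → P x → ∃ λ y → Q y × R x y) →
  (∀ {y} → Q y → ∃ λ x → P x × R x y) →
  (∀ {x y y′} → R x y → R x y′ → y ≡ y′) →
  (∀ {x x′ y} → R x y → R x′ y → x ≡ x′) →
  ∀ {N} → HasSize P N → HasSize Q N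
HasSize-transfer {A = A} {B = B} {P} {Q} R total surjective functional injective (L , uL , spec , lenL) =
  let ys , len , u , q , ⇒ , ⇐ = image L (All.tabulate (λ {x} → Equivalence.to (spec x))) uL in
  ys , u , (λ y → mk⇔ (All.lookup q) λ qy →
    let x , px , r = surjective qy
        y′ , y′∈ , r′ = ⇐ (Equivalence.from (spec x) px)
    in subst (_∈ ys) (functional r′ r) y′∈) , trans len lenL
  where
  image : (xs : List A) → All P xs → Unique xs → ∃ λ (ys : List B) →
    length ys ≡ length xs × Unique ys × All Q ys ×
    (∀ {y} → y ∈ ys → ∃ λ x → x ∈ xs × R x y) × (∀ {x} → x ∈ xs → ∃ λ y → y ∈ ys × R x y)
  image [] [] [] = [] , refl , [] , [] , (λ ()) , λ ()
  image (x ∷ xs) (px ∷ pxs) u@(_ ∷ u′) with total px | image xs pxs u′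
  ... | y , qy , r | ys , len , uys , qys , ⇒ , ⇐ =
    y ∷ ys , cong suc len , All.tabulate fresh ∷ uys , qy ∷ qys , ⇒′ , ⇐′
    where
    fresh : ∀ {y′} → y′ ∈ ys → y ≢ y′
    fresh y′∈ refl with ⇒ y′∈
    ... | x′ , x′∈ , r′ = Unique[x∷xs]⇒x∉xs u (subst (_∈ xs) (injective r′ r) x′∈)
    ⇒′ : ∀ {y′} → y′ ∈ y ∷ ys → ∃ λ x′ → x′ ∈ x ∷ xs × R x′ y′
    ⇒′ (here refl) = x , here refl , r
    ⇒′ (there p) with ⇒ p
    ... | x′ , x′∈ , r′ = x′ , there x′∈ , r′
    ⇐′ : ∀ {x′} → x′ ∈ x ∷ xs → ∃ λ y′ → y′ ∈ y ∷ ys × R x′ y′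
    ⇐′ (here refl) = y , here refl , r
    ⇐′ (there p) with ⇐ p
    ... | y′ , y′∈ , r′ = y′ , there y′∈ , r′

-- Permutations as words, decidably.

length-[n] : ∀ n → length [ n ] ≡ n
length-[n] n = trans (length-map suc (upTo n)) (length-upTo n)

Unique-[n] : ∀ n → Unique [ n ]
Unique-[n] n = Unique-map⁺ suc-injective (upTo⁺ n)

∈-[n]⁺ : ∀ {i n} → i < n → suc i ∈ [ n ]
∈-[n]⁺ i<n = ∈-map⁺ suc (∈-upTo⁺ i<n)

∈-[n]⁻ : ∀ {x n} → x ∈ [ n ] → ∃ λ i → i < n × x ≡ suc i
∈-[n]⁻ x∈ with ∈-map⁻ suc x∈
... | i , i∈ , e = i , ∈-upTo⁻ i∈ , e

-- By pigeonhole, n distinct letters of `[ n ]` exhaust it. Each of the three conditions is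
-- decidable, whence `isPerm?`.
isPerm⁺ : ∀ {n xs} → Unique xs → All (_∈ [ n ]) xs → length xs ≡ n → IsPerm n xs
isPerm⁺ {n} u r len = pigeonhole u (All.lookup r) (≤-reflexive (trans (length-[n] n) (sym len)))

isPerm⇒length : ∀ {n xs} → IsPerm n xs → length xs ≡ n
isPerm⇒length {n} p = trans (↭-length p) (length-[n] n)

isPerm⇒Unique : ∀ {n xs} → IsPerm n xs → Unique xs
isPerm⇒Unique {n} p = Unique-resp-↭ (↭-sym p) (Unique-[n] n)

isPerm⇒All : ∀ {n xs} → IsPerm n xs → All (_∈ [ n ]) xs
isPerm⇒All p = All.tabulate (∈-resp-↭ p)

isPerm? : ∀ n → Decidable (IsPerm n)
isPerm? n xs = map′ (λ (u , r , l) → isPerm⁺ u r l) (λ p → isPerm⇒Unique p , isPerm⇒All p , isPerm⇒length p)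
  (allPairs? (λ x y → ¬? (x ≟ y)) xs ×-dec All.all? (λ x → any? (x ≟_) [ n ]) xs ×-dec (length xs ≟ n))

words : ℕ → List A → List (List A)
words zero    as = [] ∷ []
words (suc n) as = cartesianProductWith _∷_ as (words n as)

∈-words : ∀ {as : List A} {xs} → All (_∈ as) xs → xs ∈ words (length xs) as
∈-words []       = here refl
∈-words (p ∷ ps) = ∈-cartesianProductWith⁺ _∷_ p (∈-words ps)

∃⊆? : {Q : List A → Set} → Decidable Q → ∀ w → Dec (∃ λ s → s ⊆ w × Q s)
∃⊆? Q? []      = map′ (λ q → [] , [] , q) (λ { ([] , [] , q) → q }) (Q? [])
∃⊆? Q? (x ∷ w) = map′
  (λ { (inj₁ (s , τ , q)) → x ∷ s , refl ∷ τ , q ; (inj₂ (s , τ , q)) → s , x ∷ʳ τ , q })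
  (λ { (_ , refl ∷ τ , q) → inj₁ (_ , τ , q) ; (_ , _ ∷ʳ τ , q) → inj₂ (_ , τ , q) })
  (∃⊆? (λ s → Q? (x ∷ s)) w ⊎-dec ∃⊆? Q? w)

-- Occurrences of 12⋯k as increasing subsequences.

Increasing : List ℕ → Set
Increasing = AllPairs _<_

lookup-[k] : ∀ k (i : Fin (length [ k ])) → lookup [ k ] i ≡ suc (toℕ i)
lookup-[k] k = go id k
  where
  go : ∀ (f : ℕ → ℕ) n (i : Fin (length (map suc (applyUpTo f n)))) →
    lookup (map suc (applyUpTo f n)) i ≡ suc (f (toℕ i))
  go f (suc n) Fin.zero    = refl
  go f (suc n) (Fin.suc i) = go (f ∘ suc) n i

lookup-cast-[k] : ∀ {m} k (eq : m ≡ length [ k ]) (i : Fin m) → lookup [ k ] (cast eq i) ≡ suc (toℕ i)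
lookup-cast-[k] k eq i = trans (lookup-[k] k (cast eq i)) (cong suc (toℕ-cast eq i))

increasing-lookup : ∀ {s} → Increasing s → ∀ i j → toℕ i < toℕ j → lookup s i < lookup s j
increasing-lookup {x ∷ s} (lt ∷ _) Fin.zero    (Fin.suc j) _  = All.lookup lt (∈-lookup j)
increasing-lookup {x ∷ s} (_ ∷ inc) (Fin.suc i) (Fin.suc j) i<j = increasing-lookup inc i j (s≤s⁻¹ i<j)

orderIso⁺ : ∀ {k s} → length s ≡ k → Increasing s → OrderIso s [ k ]
orderIso⁺ {k} {s} len inc = eq , λ a b → mk⇔ (to a b) (from a b)
  where
  eq = trans len (sym (length-[n] k))
  to : ∀ a b → lookup s a ≤ lookup s b → lookup [ k ] (cast eq a) ≤ lookup [ k ] (cast eq b)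
  to a b le rewrite lookup-cast-[k] k eq a | lookup-cast-[k] k eq b =
    s≤s (≮⇒≥ λ b<a → <⇒≱ (increasing-lookup inc b a b<a) le)
  from : ∀ a b → lookup [ k ] (cast eq a) ≤ lookup [ k ] (cast eq b) → lookup s a ≤ lookup s b
  from a b le rewrite lookup-cast-[k] k eq a | lookup-cast-[k] k eq b with m≤n⇒m<n∨m≡n (s≤s⁻¹ le)
  ... | inj₁ a<b = <⇒≤ (increasing-lookup inc a b a<b)
  ... | inj₂ a≡b = ≤-reflexive (cong (lookup s) (toℕ-injective a≡b))

orderIso⁻ : ∀ {k s} → OrderIso s [ k ] → length s ≡ k × Increasing s
orderIso⁻ {k} {s} (eq , iso) = trans eq (length-[n] k) ,
  subst Increasing (tabulate-lookup s) (AllPairs.tabulate⁺-< λ {i} {j} i<j →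
    ≰⇒> λ le → <⇒≱ i<j (s≤s⁻¹ (subst₂ _≤_ (lookup-cast-[k] k eq j) (lookup-cast-[k] k eq i) (Equivalence.to (iso j i) le))))

avoids? : ∀ k w → Dec (Avoids w [ k ])
avoids? k w = ¬? (map′ (λ (s , τ , len , inc) → s , τ , orderIso⁺ len inc) (λ (s , τ , iso) → s , τ , orderIso⁻ iso)
  (∃⊆? (λ s → (length s ≟ k) ×-dec allPairs? _<?_ s) w))

-- Counting the words by their first halves.

double : List A → List A
double π = π ++ reverse π

AvoidingPerm : ℕ → ℕ → List ℕ → Set
AvoidingPerm n k π = IsPerm n π × Avoids (double π) [ k ]

AvoidingPerm-HasSize : ∀ n k → ∃ (HasSize (AvoidingPerm n k))
AvoidingPerm-HasSize n k = HasSize-decidable (≡-dec _≟_) (λ π → isPerm? n π ×-dec avoids? k (double π))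
  (words n [ n ]) λ π (p , _) → subst (λ l → π ∈ words l [ n ]) (isPerm⇒length p) (∈-words (isPerm⇒All p))

++-injectiveˡ : (xs ys : List A) {us vs : List A} → length xs ≡ length ys → xs ++ us ≡ ys ++ vs → xs ≡ ys
++-injectiveˡ []       []       _  _  = refl
++-injectiveˡ (x ∷ xs) (y ∷ ys) le eq = cong₂ _∷_ (∷-injectiveˡ eq) (++-injectiveˡ xs ys (suc-injective le) (∷-injectiveʳ eq))

InRAvoid-HasSize : ∀ {n k N} → HasSize (AvoidingPerm n k) N → HasSize (InRAvoid n [ k ]) N
InRAvoid-HasSize {n} {k} = HasSize-transfer (λ π w → IsPerm n π × w ≡ double π)
  (λ {π} (p , av) → double π , ((π , p , refl) , av) , p , refl)
  (λ { ((π , p , refl) , av) → π , (p , av) , p , refl })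
  (λ (_ , e) (_ , e′) → trans e (sym e′))
  (λ {π} {π′} (p , e) (p′ , e′) → ++-injectiveˡ π π′ (trans (isPerm⇒length p) (sym (isPerm⇒length p′))) (trans (sym e) e′))

-- Lengths of longest chains.

-- The number of steps in a longest chain ending at each position, described without chains: `mono`
-- bounds it from below, `tight` from above.
record Rank (n : ℕ) (R : ℕ → ℕ → Set) (a : ℕ → ℕ) : Set where
  field
    mono  : ∀ {i j} → i < j → j < n → R i j → a i < a j
    tight : ∀ {j x} → j < n → a j ≡ suc x → ∃ λ i → i < j × R i j × a i ≡ x

open Rank

-- Following `tight` down from j gives a chain of `a j` steps, and `a′` grows at each of them.
-- Applied both ways, this makes ranks unique.
rank-≤ : ∀ {n R R′ a a′} → (∀ {i j} → i < j → j < n → R i j → R′ i j) →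
  Rank n R a → Rank n R′ a′ → ∀ {j} → j < n → a j ≤ a′ j
rank-≤ {n} {R} {R′} {a} {a′} R⇒R′ r r′ j<n = go _ j<n refl
  where
  go : ∀ x {j} → j < n → a j ≡ x → x ≤ a′ j
  go zero    _   _  = z≤n
  go (suc x) j<n eq with tight r j<n eq
  ... | i , i<j , rij , ai≡x = ≤-<-trans (go x (<-trans i<j j<n) ai≡x) (mono r′ i<j j<n (R⇒R′ i<j j<n rij))

rank-exists : ∀ {R : ℕ → ℕ → Set} → (∀ i j → Dec (R i j)) → ∀ n → ∃ (Rank n R)
rank-exists R? zero = (λ _ → 0) , record { mono = λ _ () ; tight = λ () }
rank-exists {R} R? (suc n) with rank-exists R? n
... | a , r = a′ , record { mono = mono′ ; tight = tight′ }
  where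
  -- The rank of the new position n: the maximum of `suc (a i)` over the i < m related to n, and 0
  -- if there are none.
  sup : ∀ m → ∃ λ M → (∀ {i} → i < m → R i n → a i < M) ×
                      (∀ {x} → M ≡ suc x → ∃ λ i → i < m × R i n × a i ≡ x)
  sup zero = 0 , (λ ()) , λ ()
  sup (suc m) with sup m | R? m n
  ... | M , ub , att | no ¬r = M , ub′ , λ eq → let i , i<m , ρ = att eq in i , m<n⇒m<1+n i<m , ρ
    where
    ub′ : ∀ {i} → i < suc m → R i n → a i < M
    ub′ i<1+m ρ with m<1+n⇒m<n∨m≡n i<1+m
    ... | inj₁ i<m  = ub i<m ρ
    ... | inj₂ refl = contradiction ρ ¬r
  ... | M , ub , att | yes r with a m <? M
  ...   | yes am<M = M , ub′ , λ eq → let i , i<m , ρ = att eq in i , m<n⇒m<1+n i<m , ρ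
    where
    ub′ : ∀ {i} → i < suc m → R i n → a i < M
    ub′ i<1+m ρ with m<1+n⇒m<n∨m≡n i<1+m
    ... | inj₁ i<m  = ub i<m ρ
    ... | inj₂ refl = am<M
  ...   | no am≮M = suc (a m) , ub′ , λ eq → m , ≤-refl , r , suc-injective eq
    where
    ub′ : ∀ {i} → i < suc m → R i n → a i < suc (a m)
    ub′ i<1+m ρ with m<1+n⇒m<n∨m≡n i<1+m
    ... | inj₁ i<m  = m<n⇒m<1+n (<-≤-trans (ub i<m ρ) (≮⇒≥ am≮M))
    ... | inj₂ refl = ≤-refl
  M = proj₁ (sup n)
  a′ : ℕ → ℕ
  a′ i with i ≟ n
  ... | yes _ = M
  ... | no _  = a i
  a′-n : a′ n ≡ M
  a′-n with n ≟ n
  ... | yes _  = refl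
  ... | no n≢n = contradiction refl n≢n
  a′-< : ∀ {i} → i < n → a′ i ≡ a i
  a′-< {i} i<n with i ≟ n
  ... | yes i≡n = contradiction i≡n (<⇒≢ i<n)
  ... | no _    = refl
  mono′ : ∀ {i j} → i < j → j < suc n → R i j → a′ i < a′ j
  mono′ i<j j<1+n ρ with m<1+n⇒m<n∨m≡n j<1+n
  ... | inj₁ j<n  = subst₂ _<_ (sym (a′-< (<-trans i<j j<n))) (sym (a′-< j<n)) (mono r i<j j<n ρ)
  ... | inj₂ refl = subst₂ _<_ (sym (a′-< i<j)) (sym a′-n) (proj₁ (proj₂ (sup n)) i<j ρ)
  tight′ : ∀ {j x} → j < suc n → a′ j ≡ suc x → ∃ λ i → i < j × R i j × a′ i ≡ x
  tight′ j<1+n eq with m<1+n⇒m<n∨m≡n j<1+n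
  ... | inj₁ j<n  = let i , i<j , ρ , ai = tight r j<n (trans (sym (a′-< j<n)) eq)
                    in i , i<j , ρ , trans (a′-< (<-trans i<j j<n)) ai
  ... | inj₂ refl = let i , i<n , ρ , ai = proj₂ (proj₂ (sup n)) (trans (sym a′-n) eq)
                    in i , i<n , ρ , trans (a′-< i<n) ai

-- Avoidance in terms of labels.

IncRank DecRank : ℕ → (ℕ → ℕ) → (ℕ → ℕ) → Set
IncRank n h = Rank n λ i j → h i < h j
DecRank n h = Rank n λ i j → h j < h i

double-map-upTo : ∀ (h : ℕ → ℕ) n → double (map h (upTo n)) ≡ map h (upTo n) ++ map h (downFrom n)
double-map-upTo h n = cong (map h (upTo n) ++_) (trans (sym (reverse-map h (upTo n))) (cong (map h) (reverse-upTo n)))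

⊆-map⁻ : (f : A → B) {s : List B} (xs : List A) → s ⊆ map f xs → ∃ λ t → t ⊆ xs × s ≡ map f t
⊆-map⁻ f []       []         = [] , [] , refl
⊆-map⁻ f (x ∷ xs) (_ ∷ʳ τ)   = let t , τ′ , e = ⊆-map⁻ f xs τ in t , x ∷ʳ τ′ , e
⊆-map⁻ f (x ∷ xs) (refl ∷ τ) = let t , τ′ , e = ⊆-map⁻ f xs τ in x ∷ t , refl ∷ τ′ , cong (f x ∷_) e

increasing-length : ∀ {m xs} → Increasing xs → All (_< m) xs → length xs ≤ m
increasing-length [] [] = z≤n
increasing-length {m} (lt ∷ inc) (x<m ∷ bound) = ≤-trans (m≤m+n _ _) (go (lt ∷ inc) (x<m ∷ bound))
  where
  -- The bound includes the head, whose growth by at least one pays for each entry dropped from the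
  -- length.
  go : ∀ {x xs} → Increasing (x ∷ xs) → All (_< m) (x ∷ xs) → suc (length xs) + x ≤ m
  go (_ ∷ []) (x<m ∷ []) = x<m
  go {xs = _ ∷ xs} ((x<y ∷ _) ∷ inc) (_ ∷ bound) =
    ≤-trans (s≤s (+-monoʳ-< (length xs) x<y)) (go inc bound)

AllPairs-resp-⊆ : {R : A → A → Set} {xs ys : List A} → xs ⊆ ys → AllPairs R ys → AllPairs R xs
AllPairs-resp-⊆ []         []         = []
AllPairs-resp-⊆ (_ ∷ʳ τ)   (_ ∷ rs)   = AllPairs-resp-⊆ τ rs
AllPairs-resp-⊆ (refl ∷ τ) (r ∷ rs)   = Sub.All-resp-⊆ τ r ∷ AllPairs-resp-⊆ τ rs

-- A letter at position i weighs a i in the first half of the word and m ∸ 1 ∸ b i in the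
-- second; along an increasing subsequence the weights increase strictly and stay below m.
labels⇒avoids : ∀ {m n h a b} → IncRank n h a → DecRank n h b →
  (∀ {i} → i < n → a i + b i < m) → Avoids (double (map h (upTo n))) [ suc m ]
labels⇒avoids {m} {n} {h} {a} {b} ra rb range (s , τ , iso) =
  let len , inc = orderIso⁻ iso
      t , τ′ , eq = ⊆-map⁻ proj₁ D (subst (s ⊆_) (trans (double-map-upTo h n) (sym map-D)) τ)
      weights = AllPairs.map⁺ (AllPairs.zipWith (λ (f , x) → f x)
        (AllPairs-resp-⊆ τ′ compatible , AllPairs.map⁻ (subst Increasing eq inc)))
      length-t = trans (length-map proj₂ t) (trans (sym (length-map proj₁ t)) (trans (cong length (sym eq)) len))
  in <-irrefl refl (subst (_≤ m) length-t (increasing-length weights (All.map⁺ (Sub.All-resp-⊆ τ′ bounded))))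
  where
  D₁ = map (λ i → h i , a i) (upTo n)
  D₂ = map (λ i → h i , m ∸ suc (b i)) (downFrom n)
  D = D₁ ++ D₂
  map-D : map proj₁ D ≡ map h (upTo n) ++ map h (downFrom n)
  map-D = trans (map-++ proj₁ D₁ D₂) (cong₂ _++_ (sym (map-∘ (upTo n))) (sym (map-∘ (downFrom n))))
  Compatible : ℕ × ℕ → ℕ × ℕ → Set
  Compatible (x , u) (y , v) = x < y → u < v
  room : ∀ {i} → i < n → suc (b i) ≤ m
  room i<n = ≤-trans (s≤s (m≤n+m _ _)) (range i<n)
  bounded : All (λ p → proj₂ p < m) D
  bounded = All.++⁺
    (All.map⁺ (All.tabulate λ i∈ → ≤-trans (s≤s (m≤m+n _ _)) (range (∈-upTo⁻ i∈))))
    (All.map⁺ (All.tabulate λ i∈ → ∸-monoʳ-< (s≤s z≤n) (room (∈-downFrom⁻ i∈))))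
  -- A rise from position i of the first half to position j of the second: if i < j then
  -- `a i < a j`, so the sum is compared with `a j + b j`; if j < i then `b j < b i`, so it is
  -- compared with `a i + b i`.
  cross : ∀ {i j} → i < n → j < n → h i < h j → a i < m ∸ suc (b j)
  cross {i} {j} i<n j<n lt = m+n≤o⇒m≤o∸n (suc (a i)) (subst (_≤ m) (cong suc (sym (+-suc (a i) (b j)))) (sum<m (<-cmp i j)))
    where
    sum<m : _ → suc (a i + b j) < m
    sum<m (tri< i<j _ _) = ≤-<-trans (+-monoˡ-≤ (b j) (mono ra i<j j<n lt)) (range j<n)
    sum<m (tri≈ _ refl _) = contradiction lt (<-irrefl refl)
    sum<m (tri> _ _ j<i) = ≤-<-trans (≤-trans (≤-reflexive (sym (+-suc (a i) (b j)))) (+-monoʳ-≤ (a i) (mono rb j<i i<n lt))) (range i<n)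
  compatible : AllPairs Compatible D
  compatible = AllPairs.++⁺
    (AllPairs.map⁺ (AllPairs.applyUpTo⁺₁ id n λ i<j j<n lt → mono ra i<j j<n lt))
    (AllPairs.map⁺ (AllPairs.applyDownFrom⁺₁ id n λ j<i i<n lt →
      ∸-monoʳ-< (s≤s (mono rb j<i i<n lt)) (room i<n)))
    (All.map⁺ (All.tabulate λ i∈ → All.map⁺ (All.tabulate λ j∈ →
      cross (∈-upTo⁻ i∈) (∈-downFrom⁻ j∈))))

downFrom-⊆ : ∀ {i j} → i ≤ j → downFrom i ⊆ downFrom j
downFrom-⊆ i≤j = go (≤⇒≤′ i≤j)
  where
  go : ∀ {i j} → i ≤′ j → downFrom i ⊆ downFrom j
  go ≤′-refl     = ⊆-refl
  go (≤′-step p) = _ ∷ʳ go p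

upTo-⊆ : ∀ {i j} → i ≤ j → upTo i ⊆ upTo j
upTo-⊆ {i} {j} i≤j = subst₂ _⊆_ (reverse-downFrom i) (reverse-downFrom j) (Sub.reverse⁺ (downFrom-⊆ i≤j))

-- Iterating `tight` collects the predecessors. `h i` is left out, so that this chain can be joined
-- there to that of `decRank-chain`.
incRank-chain : ∀ {n h a} → IncRank n h a → ∀ {i} → i < n →
  ∃ λ s → s ⊆ map h (upTo i) × length s ≡ a i × Increasing s × All (_< h i) s
incRank-chain {n} {h} {a} ra i<n = go _ i<n refl
  where
  go : ∀ x {i} → i < n → a i ≡ x →
    ∃ λ s → s ⊆ map h (upTo i) × length s ≡ a i × Increasing s × All (_< h i) s
  go zero i<n eq = [] , minimum _ , sym eq , [] , []
  go (suc x) {i} i<n eq with tight ra i<n eq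
  ... | j , j<i , hj<hi , aj≡x with go x (<-trans j<i i<n) aj≡x
  ... | s , τ , len , inc , below =
    s ++ h j ∷ [] ,
    ⊆-trans (Sub.++⁺ τ ⊆-refl) (subst (_⊆ map h (upTo i)) (trans (cong (map h) (sym (upTo-∷ʳ j))) (map-++ h (upTo j) (j ∷ []))) (Sub.map⁺ h (upTo-⊆ j<i))) ,
    trans (length-++ s) (trans (+-comm (length s) 1) (trans (cong suc (trans len aj≡x)) (sym eq))) ,
    AllPairs.++⁺ inc ([] ∷ []) (All.map (_∷ []) below) ,
    All.++⁺ (All.map (λ lt → <-trans lt hj<hi) below) (hj<hi ∷ [])

-- A decreasing subsequence of π becomes increasing in the reversed half; hence `downFrom`, and
-- predecessors put in front.
decRank-chain : ∀ {n h b} → DecRank n h b → ∀ {i} → i < n →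
  ∃ λ s → s ⊆ map h (downFrom i) × length s ≡ b i × Increasing s × All (h i <_) s
decRank-chain {n} {h} {b} rb i<n = go _ i<n refl
  where
  go : ∀ x {i} → i < n → b i ≡ x →
    ∃ λ s → s ⊆ map h (downFrom i) × length s ≡ b i × Increasing s × All (h i <_) s
  go zero i<n eq = [] , minimum _ , sym eq , [] , []
  go (suc x) {i} i<n eq with tight rb i<n eq
  ... | j , j<i , hi<hj , bj≡x with go x (<-trans j<i i<n) bj≡x
  ... | s , τ , len , inc , above =
    h j ∷ s , ⊆-trans (refl ∷ τ) (Sub.map⁺ h (downFrom-⊆ j<i)) ,
    trans (cong suc (trans len bj≡x)) (sym eq) , above ∷ inc , hi<hj ∷ All.map (<-trans hi<hj) above

-- If `m ≤ a i + b i`, the two chains joined at `h i` have at least m + 1 letters, and the first m +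
-- 1 of them form the forbidden pattern.
avoids⇒labels : ∀ {m n h a b} → IncRank n h a → DecRank n h b →
  Avoids (double (map h (upTo n))) [ suc m ] → ∀ {i} → i < n → a i + b i < m
avoids⇒labels {m} {n} {h} {a} {b} ra rb avoids {i} i<n with incRank-chain ra i<n | decRank-chain rb i<n
... | s , σ , lenₛ , incₛ , below | t , τ , lenₜ , incₜ , above = ≰⇒> λ m≤ →
    avoids (take (suc m) u , ⊆-trans (Sub.take-⊆ (suc m) u) u⊆ ,
      orderIso⁺ (trans (length-take (suc m) u) (m≤n⇒m⊓n≡m (≤-trans (s≤s m≤) (≤-reflexive (sym lenᵤ)))))
                (AllPairs.take⁺ (suc m) incᵤ))
  where
  u = s ++ h i ∷ t
  u⊆ : u ⊆ double (map h (upTo n))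
  u⊆ = subst (u ⊆_) (sym (double-map-upTo h n))
    -- `h i` is taken from the reversed half, where `t` follows it; `s` lies in the first half.
    (Sub.++⁺ (⊆-trans σ (Sub.map⁺ h (upTo-⊆ (<⇒≤ i<n)))) (⊆-trans (refl ∷ τ) (Sub.map⁺ h (downFrom-⊆ i<n))))
  lenᵤ : length u ≡ suc (a i + b i)
  lenᵤ = trans (length-++ s) (trans (cong₂ (λ x y → x + suc y) lenₛ lenₜ) (+-suc (a i) (b i)))
  incᵤ : Increasing u
  incᵤ = AllPairs.++⁺ incₛ (above ∷ incₜ) (All.map (λ lt → lt ∷ All.map (<-trans lt) above) below)

-- Staircase tableaux as functions on cells.

top : ℕ → ℕ × ℕ
top c = 0 , c

down : ℕ × ℕ → ℕ × ℕ
down (r , c) = suc r , c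

-- With coordinates counted from 0, the staircase with m rows is `r + c < m`; below its first row
-- lies a smaller staircase.
cells : ℕ → List (ℕ × ℕ)
cells zero    = []
cells (suc m) = map top (upTo (suc m)) ++ map down (cells m)

size : ℕ → ℕ
size m = length (cells m)

∈-cells⁺ : ∀ {m r c} → r + c < m → (r , c) ∈ cells m
∈-cells⁺ {suc m} {zero}  lt = ∈-++⁺ˡ (∈-map⁺ top (∈-upTo⁺ lt))
∈-cells⁺ {suc m} {suc r} lt = ∈-++⁺ʳ _ (∈-map⁺ _ (∈-cells⁺ (s≤s⁻¹ lt)))

∈-cells⁻ : ∀ {m r c} → (r , c) ∈ cells m → r + c < m
∈-cells⁻ {suc m} x∈ with ∈-++⁻ (map top (upTo (suc m))) x∈
... | inj₁ p with ∈-map⁻ top p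
...   | _ , c∈ , refl = ∈-upTo⁻ c∈
∈-cells⁻ {suc m} x∈ | inj₂ p with ∈-map⁻ _ p
...   | _ , q , refl = s≤s (∈-cells⁻ q)

-- A new top row has m + 1 cells, so the recursion is Pascal's rule.
size≡C : ∀ m → size m ≡ suc m C 2
size≡C zero    = refl
size≡C (suc m) = begin
  size (suc m)              ≡⟨ length-++ (map top (upTo (suc m))) {map down (cells m)} ⟩
  length (map top (upTo (suc m))) + length (map down (cells m))
    ≡⟨ cong₂ _+_ (trans (length-map top (upTo (suc m))) (length-upTo (suc m))) (length-map down (cells m)) ⟩
  suc m + size m            ≡⟨ cong₂ _+_ (sym (nC1≡n (suc m))) (size≡C m) ⟩
  suc m C 1 + suc m C 2     ≡⟨ nCk+nC[k+1]≡[n+1]C[k+1] (suc m) 1 ⟩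
  suc (suc m) C 2           ∎
  where open ≡-Reasoning

-- The staircase filling whose (r + 1, c + 1) entry is t r c.
tableau : ℕ → (ℕ → ℕ → ℕ) → Tableau
tableau zero    t = []
tableau (suc m) t = applyUpTo (t 0) (suc m) ∷ tableau m (t ∘ suc)

concat-tableau : ∀ m t → concat (tableau m t) ≡ map (uncurry t) (cells m)
concat-tableau zero    t = refl
concat-tableau (suc m) t = sym (trans (map-++ (uncurry t) (map top (upTo (suc m))) _)
  (cong₂ _++_ (trans (sym (map-∘ (upTo (suc m)))) (map-upTo (t 0) (suc m)))
              (trans (sym (map-∘ (cells m))) (sym (concat-tableau m (t ∘ suc))))))

shape-tableau : ∀ m t → map length (tableau m t) ≡ staircase (suc m)
shape-tableau zero    t = refl
shape-tableau (suc m) t = cong₂ _∷_ (length-applyUpTo (t 0) (suc m)) (shape-tableau m (t ∘ suc))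

applyUpTo-surjective : (xs : List ℕ) → ∃ λ f → xs ≡ applyUpTo f (length xs)
applyUpTo-surjective []       = (λ _ → 0) , refl
applyUpTo-surjective (x ∷ xs) with applyUpTo-surjective xs
... | f , eq = (λ { zero → x ; (suc i) → f i }) , cong (x ∷_) eq

-- Lets every tableau of staircase shape be handled as a function of the cell; values off the
-- staircase are fillers.
tableau-surjective : ∀ m {T} → map length T ≡ staircase (suc m) → ∃ λ t → T ≡ tableau m t
tableau-surjective zero    {[]}      _  = (λ _ _ → 0) , refl
tableau-surjective (suc m) {row ∷ T} eq with applyUpTo-surjective row | tableau-surjective m (∷-injectiveʳ eq)
... | f , row≡ | t , T≡ = (λ { zero → f ; (suc r) → t r }) ,
  cong₂ _∷_ (trans row≡ (cong (applyUpTo f) (∷-injectiveˡ eq))) T≡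

applyUpTo-cong : ∀ {f g : ℕ → A} n → (∀ {i} → i < n → f i ≡ g i) → applyUpTo f n ≡ applyUpTo g n
applyUpTo-cong zero    f≗g = refl
applyUpTo-cong (suc n) f≗g = cong₂ _∷_ (f≗g (s≤s z≤n)) (applyUpTo-cong n λ i<n → f≗g (s≤s i<n))

applyUpTo-injective : ∀ {f g : ℕ → A} n → applyUpTo f n ≡ applyUpTo g n → ∀ {i} → i < n → f i ≡ g i
applyUpTo-injective (suc n) eq {zero}  _   = ∷-injectiveˡ eq
applyUpTo-injective (suc n) eq {suc i} i<n = applyUpTo-injective n (∷-injectiveʳ eq) (s≤s⁻¹ i<n)

tableau-cong : ∀ m {t u} → (∀ {r c} → r + c < m → t r c ≡ u r c) → tableau m t ≡ tableau m u
tableau-cong zero    t≗u = refl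
tableau-cong (suc m) t≗u = cong₂ _∷_ (applyUpTo-cong (suc m) λ {c} → t≗u {0} {c}) (tableau-cong m λ lt → t≗u (s≤s lt))

tableau-injective : ∀ m {t u} → tableau m t ≡ tableau m u → ∀ {r c} → r + c < m → t r c ≡ u r c
tableau-injective (suc m) {t} {u} eq {zero}  lt = applyUpTo-injective {f = t 0} {u 0} (suc m) (∷-injectiveˡ eq) lt
tableau-injective (suc m) eq {suc r} lt = tableau-injective m (∷-injectiveʳ eq) (s≤s⁻¹ lt)

nth-applyUpTo⁺ : ∀ {f : ℕ → A} {n i} → i < n → nth (applyUpTo f n) i ≡ just (f i)
nth-applyUpTo⁺ {n = suc n} {zero}  _   = refl
nth-applyUpTo⁺ {n = suc n} {suc i} i<n = nth-applyUpTo⁺ (s≤s⁻¹ i<n)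

nth-applyUpTo⁻ : ∀ {f : ℕ → A} {n i x} → nth (applyUpTo f n) i ≡ just x → i < n × x ≡ f i
nth-applyUpTo⁻ {n = suc n} {zero}  refl = s≤s z≤n , refl
nth-applyUpTo⁻ {n = suc n} {suc i} eq with nth-applyUpTo⁻ {n = n} {i} eq
... | i<n , e = s≤s i<n , e

entry-nth : ∀ T r c → entry T (suc r) (suc c) ≡ (nth T r >>= λ row → nth row c)
entry-nth T r c with nth T r
... | nothing = refl
... | just _  = refl

entry-tableau⁺ : ∀ {m t r c} → r + c < m → entry (tableau m t) (suc r) (suc c) ≡ just (t r c)
entry-tableau⁺ {m} {t} {r} {c} lt = trans (entry-nth (tableau m t) r c) (go m lt)
  where
  go : ∀ m {t r} → r + c < m → (nth (tableau m t) r >>= λ row → nth row c) ≡ just (t r c)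
  go (suc m) {t} {zero}  lt = nth-applyUpTo⁺ {f = t 0} lt
  go (suc m) {r = suc r} lt = go m (s≤s⁻¹ lt)

entry-tableau⁻ : ∀ {m t i j x} → entry (tableau m t) i j ≡ just x →
  ∃₂ λ r c → i ≡ suc r × j ≡ suc c × r + c < m × x ≡ t r c
entry-tableau⁻ {m} {t} {suc r} {suc c} {x} eq =
  let lt , e = go m (trans (sym (entry-nth (tableau m t) r c)) eq) in r , c , refl , refl , lt , e
  where
  go : ∀ m {t r} → (nth (tableau m t) r >>= λ row → nth row c) ≡ just x → r + c < m × x ≡ t r c
  go (suc m) {t} {zero} eq = nth-applyUpTo⁻ {f = t 0} eq
  go (suc m) {r = suc r} eq with go m {r = r} eq
  ... | lt , e = s≤s lt , e

record Standard (m : ℕ) (t : ℕ → ℕ → ℕ) : Set where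
  field
    perm : IsPerm (size m) (map (uncurry t) (cells m))
    row< : ∀ {r c} → r + suc c < m → t r c < t r (suc c)
    col< : ∀ {r c} → suc r + c < m → t r c < t (suc r) c

open Standard

Diagonal : ℕ → (ℕ → ℕ → ℕ) → Set
Diagonal m t = ∀ {r c} → suc r + c < m → t (suc r) c < t r (suc c)

length-concat-tableau : ∀ m t → length (concat (tableau m t)) ≡ size m
length-concat-tableau m t = trans (cong length (concat-tableau m t)) (length-map (uncurry t) (cells m))

isSYT⁺ : ∀ {m t} → Standard m t → IsSYT (staircase (suc m)) (tableau m t)
isSYT⁺ {m} {t} s = shape-tableau m t ,
  subst₂ (λ n xs → xs ↭ [ n ]) (sym (length-concat-tableau m t)) (sym (concat-tableau m t)) (perm s) , rows , cols
  where
  rows : ∀ i j x y → entry (tableau m t) i j ≡ just x → entry (tableau m t) i (suc j) ≡ just y → x < y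
  rows i j x y eq eq′ with entry-tableau⁻ {m} {t} {i} {j} eq | entry-tableau⁻ {m} {t} {i} {suc j} eq′
  ... | r , c , refl , refl , _ , refl | _ , _ , refl , refl , lt , refl = row< s lt
  cols : ∀ i j x y → entry (tableau m t) i j ≡ just x → entry (tableau m t) (suc i) j ≡ just y → x < y
  cols i j x y eq eq′ with entry-tableau⁻ {m} {t} {i} {j} eq | entry-tableau⁻ {m} {t} {suc i} {j} eq′
  ... | r , c , refl , refl , _ , refl | _ , _ , refl , refl , lt , refl = col< s lt

isSYT⁻ : ∀ {m t} → IsSYT (staircase (suc m)) (tableau m t) → Standard m t
isSYT⁻ {m} {t} (_ , p , rows , cols) = record
  { perm = subst₂ (λ n xs → xs ↭ [ n ]) (length-concat-tableau m t) (concat-tableau m t) p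
  ; row< = λ {r} {c} lt → rows (suc r) (suc c) _ _
      (entry-tableau⁺ (<-trans (+-monoʳ-< r ≤-refl) lt)) (entry-tableau⁺ lt)
  ; col< = λ {r} {c} lt → cols (suc r) (suc c) _ _ (entry-tableau⁺ (<-trans ≤-refl lt)) (entry-tableau⁺ lt)
  }

diagonals⁺ : ∀ {m t} → Diagonal m t → IncreasingDiagonals (suc m) (tableau m t)
diagonals⁺ {m} {t} d (suc i) j x y _ _ _ _ eq eq′ with entry-tableau⁻ {m} {t} {suc i} {j} eq | entry-tableau⁻ {m} {t} {i} {suc j} eq′
... | _ , c , refl , refl , lt , refl | r , _ , refl , refl , _ , refl = d lt

diagonals⁻ : ∀ {m t} → IncreasingDiagonals (suc m) (tableau m t) → Diagonal m t
-- In 1-based indices with k = m + 1, the bounds are r + 2 ≤ m and c + 1 ≤ m - 1; both follow from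
-- the cell (r + 1, c) lying in the staircase.
diagonals⁻ {m} d {r} {c} lt = d (suc (suc r)) (suc c) _ _ (s≤s (s≤s z≤n)) (≤-trans (s≤s (m≤m+n (suc r) c)) lt)
  (s≤s z≤n) (m+n≤o⇒m≤o∸n (suc c) (≤-trans (≤-trans (≤-reflexive (+-comm (suc c) 1)) (s≤s (s≤s (m≤n+m c r)))) lt))
  (entry-tableau⁺ lt) (entry-tableau⁺ (subst (_< m) (sym (+-suc r c)) lt))

-- Column reflection and the correspondence.

-- The reflection (r , c) ↦ (corow m r c , c) of each column of the staircase.
corow : ℕ → ℕ → ℕ → ℕ
corow m r c = m ∸ suc (r + c)

module _ {m r c : ℕ} (lt : r + c < m) where

  private
    total : corow m r c + suc (r + c) ≡ m
    total = m∸n+n≡m lt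

  corow< : corow m r c + c < m
  corow< = subst₂ _≤_ (+-suc (corow m r c) c) total (+-monoʳ-≤ (corow m r c) (s≤s (m≤n+m c r)))

  corow-involutive : corow m (corow m r c) c ≡ r
  corow-involutive = trans (cong (_∸ suc (corow m r c + c)) (sym (trans (regroup (corow m r c) r c) total)))
                           (m+n∸m≡n (suc (corow m r c + c)) r)
    where
    regroup : ∀ x r c → suc (x + c) + r ≡ x + suc (r + c)
    regroup = solve-∀

corow-suc : ∀ {m} r c → suc r + c < m → corow m r c ≡ suc (corow m (suc r) c)
corow-suc {suc m} r c (s≤s lt) = +-∸-assoc 1 lt

-- `corow` depends on r + c alone. Thus increasing diagonals of P become increasing rows of its
-- reflection.
corow-diagonal : ∀ m r c → corow m (suc r) c ≡ corow m r (suc c)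
corow-diagonal m r c = cong (λ s → m ∸ suc s) (sym (+-suc r c))

-- The word of π = h 0 ⋯ h (n − 1) corresponds to the pair (P , Q): position i carries a label
-- (b i , a i), a cell of the staircase, where Q holds i + 1 and the column reflection of P holds h i.
record Encodes (m : ℕ) (π : List ℕ) (PQ : Tableau × Tableau) : Set where
  field
    p q     : ℕ → ℕ → ℕ
    h a b   : ℕ → ℕ
    PQ≡     : PQ ≡ (tableau m p , tableau m q)
    π≡      : π ≡ map h (upTo (size m))
    inc     : IncRank (size m) h a
    dec     : DecRank (size m) h b
    label<  : ∀ {i} → i < size m → b i + a i < m
    index   : ∀ {r c} → r + c < m → ∃ λ i → i < size m × b i ≡ r × a i ≡ c
    q-label : ∀ {i} → i < size m → q (b i) (a i) ≡ suc i
    p-label : ∀ {i} → i < size m → p (corow m (b i) (a i)) (a i) ≡ h i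

open Encodes

map-upTo-injective : ∀ {f g : ℕ → A} n → map f (upTo n) ≡ map g (upTo n) → ∀ {i} → i < n → f i ≡ g i
map-upTo-injective {f = f} {g} n eq =
  applyUpTo-injective {f = f} {g} n (trans (sym (map-upTo f n)) (trans eq (map-upTo g n)))

-- π determines `h` on the positions, and uniqueness of ranks determines the labels; as every cell
-- is a label, all entries are fixed.
encodes-functional : ∀ {m π PQ PQ′} → Encodes m π PQ → Encodes m π PQ′ → PQ ≡ PQ′
encodes-functional {m} E E′ = trans (PQ≡ E) (trans
  (cong₂ _,_ (tableau-cong m p≗) (tableau-cong m q≗)) (sym (PQ≡ E′)))
  where
  h≗ : ∀ {i} → i < size m → h E i ≡ h E′ i
  h≗ = map-upTo-injective (size m) (trans (sym (π≡ E)) (π≡ E′))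
  ranks-agree : ∀ {R R′ : ℕ → ℕ → Set} {a a′} →
    (∀ {i j} → i < size m → j < size m → R i j → R′ i j) → (∀ {i j} → i < size m → j < size m → R′ i j → R i j) →
    Rank (size m) R a → Rank (size m) R′ a′ → ∀ {j} → j < size m → a j ≡ a′ j
  ranks-agree to from r r′ j<n = ≤-antisym
    (rank-≤ (λ i<j j<n → to (<-trans i<j j<n) j<n) r r′ j<n)
    (rank-≤ (λ i<j j<n → from (<-trans i<j j<n) j<n) r′ r j<n)
  a≗ : ∀ {i} → i < size m → a E i ≡ a E′ i
  a≗ = ranks-agree (λ i< j< → subst₂ _<_ (h≗ i<) (h≗ j<)) (λ i< j< → subst₂ _<_ (sym (h≗ i<)) (sym (h≗ j<))) (inc E) (inc E′)
  b≗ : ∀ {i} → i < size m → b E i ≡ b E′ i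
  b≗ = ranks-agree (λ i< j< → subst₂ _<_ (h≗ j<) (h≗ i<)) (λ i< j< → subst₂ _<_ (sym (h≗ j<)) (sym (h≗ i<))) (dec E) (dec E′)
  q≗ : ∀ {r c} → r + c < m → q E r c ≡ q E′ r c
  q≗ {r} {c} lt with index E {r} {c} lt
  ... | i , i<n , refl , refl = trans (q-label E i<n)
    (trans (sym (q-label E′ i<n)) (cong₂ (q E′) (sym (b≗ i<n)) (sym (a≗ i<n))))
  p-corow≗ : ∀ {r c} → r + c < m → p E (corow m r c) c ≡ p E′ (corow m r c) c
  p-corow≗ {r} {c} lt with index E {r} {c} lt
  ... | i , i<n , refl , refl = trans (p-label E i<n) (trans (h≗ i<n) (trans (sym (p-label E′ i<n))
    (cong₂ (λ r c → p E′ (corow m r c) c) (sym (b≗ i<n)) (sym (a≗ i<n)))))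
  p≗ : ∀ {r c} → r + c < m → p E r c ≡ p E′ r c
  -- `p-label` speaks of reflected cells; reflecting twice reaches every cell.
  p≗ {r} {c} lt = subst (λ x → p E x c ≡ p E′ x c) (corow-involutive lt) (p-corow≗ (corow< lt))

-- Q matches the labels: the position that carries the label of i in `E′` has entry i + 1 there, so
-- it is i. Then P yields the same value.
encodes-injective : ∀ {m π π′ PQ} → Encodes m π PQ → Encodes m π′ PQ → π ≡ π′
encodes-injective {m} E E′ = trans (π≡ E) (trans
  (map-cong-local (All.tabulate λ i∈ → h≗ (∈-upTo⁻ i∈))) (sym (π≡ E′)))
  where
  PQ-eq = trans (sym (PQ≡ E)) (PQ≡ E′)
  p≗ = tableau-injective m (cong proj₁ PQ-eq)
  q≗ = tableau-injective m (cong proj₂ PQ-eq)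
  h≗ : ∀ {i} → i < size m → h E i ≡ h E′ i
  h≗ {i} i<n with index E′ {b E i} {a E i} (label< E i<n)
  ... | j , j<n , b≡ , a≡ with suc-injective (trans (sym (q-label E′ j<n))
          (trans (cong₂ (q E′) b≡ a≡) (trans (sym (q≗ (label< E i<n))) (q-label E i<n))))
  ... | refl = begin
    h E i                                        ≡⟨ p-label E i<n ⟨
    p E (corow m (b E i) (a E i)) (a E i)        ≡⟨ p≗ (corow< (label< E i<n)) ⟩
    p E′ (corow m (b E i) (a E i)) (a E i)       ≡⟨ cong₂ (λ r c → p E′ (corow m r c) c) b≡ a≡ ⟨
    p E′ (corow m (b E′ i) (a E′ i)) (a E′ i)    ≡⟨ p-label E′ i<n ⟩
    h E′ i                                       ∎
    where open ≡-Reasoning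

-- From an avoiding permutation to a pair.

encode : ∀ {m π} → AvoidingPerm (size m) (suc m) π → ∃ λ PQ → GoodPair (suc m) PQ × Encodes m π PQ
encode {m} {π} (perm-π , avoids) =
  (tableau m p₀ , tableau m q₀) , (isSYT⁺ standard-p , isSYT⁺ standard-q , diagonals⁺ {m} diagonal-p) , record
    { p = p₀ ; q = q₀ ; h = h₀ ; a = a₀ ; b = b₀ ; PQ≡ = refl ; π≡ = π≡₀ ; inc = ra ; dec = rb
    ; label< = lab< ; index = λ lt → let i , i<n , e = cover lt in i , i<n , cong proj₁ e , cong proj₂ e
    ; q-label = λ i<n → cong suc (pos-lab i<n)
    ; p-label = λ {i} i<n → trans (cong (λ r → h₀ (pos (r , a₀ i))) (corow-involutive (lab< i<n))) (cong h₀ (pos-lab i<n))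
    }
  where
  n = size m
  h₀ = proj₁ (applyUpTo-surjective π)
  π≡₀ : π ≡ map h₀ (upTo n)
  π≡₀ = trans (proj₂ (applyUpTo-surjective π)) (trans (cong (applyUpTo h₀) (isPerm⇒length perm-π)) (sym (map-upTo h₀ n)))
  h-injective : ∀ {i j} → i < n → j < n → h₀ i ≡ h₀ j → i ≡ j
  h-injective i<n j<n = Unique-map-injective (subst Unique π≡₀ (isPerm⇒Unique perm-π)) (∈-upTo⁺ i<n) (∈-upTo⁺ j<n)
  rank-a = rank-exists (λ i j → h₀ i <? h₀ j) n
  rank-b = rank-exists (λ i j → h₀ j <? h₀ i) n
  a₀ = proj₁ rank-a
  b₀ = proj₁ rank-b
  ra : IncRank n h₀ a₀
  ra = proj₂ rank-a
  rb : DecRank n h₀ b₀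
  rb = proj₂ rank-b
  lab : ℕ → ℕ × ℕ
  lab i = b₀ i , a₀ i
  lab< : ∀ {i} → i < n → b₀ i + a₀ i < m
  lab< {i} i<n = subst (_< m) (+-comm (a₀ i) (b₀ i))
    (avoids⇒labels ra rb (subst (λ w → Avoids (double w) [ suc m ]) π≡₀ avoids) i<n)

  -- If j < i, then `a` or `b` rises strictly from j to i, according to which value is larger.
  pos-mono : ∀ {i j} → i < n → j < n → i ≢ j → b₀ i ≤ b₀ j → a₀ i ≤ a₀ j → i < j
  pos-mono {i} {j} i<n j<n i≢j b≤ a≤ with <-cmp i j
  ... | tri< i<j _ _ = i<j
  ... | tri≈ _ i≡j _ = contradiction i≡j i≢j
  ... | tri> _ _ j<i with <-cmp (h₀ i) (h₀ j)
  ...   | tri< lt _ _ = contradiction b≤ (<⇒≱ (mono rb j<i i<n lt))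
  ...   | tri≈ _ eq _ = contradiction (h-injective i<n j<n eq) i≢j
  ...   | tri> _ _ lt = contradiction a≤ (<⇒≱ (mono ra j<i i<n lt))
  -- If `h₀ j < h₀ i`, then `b` rises from i to j or `a` rises from j to i, according to which
  -- position is earlier.
  val-mono : ∀ {i j} → i < n → j < n → i ≢ j → b₀ j ≤ b₀ i → a₀ i ≤ a₀ j → h₀ i < h₀ j
  val-mono {i} {j} i<n j<n i≢j b≥ a≤ with <-cmp (h₀ i) (h₀ j)
  ... | tri< lt _ _ = lt
  ... | tri≈ _ eq _ = contradiction (h-injective i<n j<n eq) i≢j
  ... | tri> _ _ lt with <-cmp i j
  ...   | tri< i<j _ _ = contradiction b≥ (<⇒≱ (mono rb i<j j<n lt))
  ...   | tri≈ _ i≡j _ = contradiction i≡j i≢j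
  ...   | tri> _ _ j<i = contradiction a≤ (<⇒≱ (mono ra j<i i<n lt))
  lab-injective : ∀ {i j} → i < n → j < n → lab i ≡ lab j → i ≡ j
  lab-injective {i} {j} i<n j<n eq with i ≟ j
  ... | yes i≡j = i≡j
  ... | no i≢j  = contradiction (pos-mono i<n j<n i≢j (≤-reflexive (cong proj₁ eq)) (≤-reflexive (cong proj₂ eq)))
    (<-asym (pos-mono j<n i<n (i≢j ∘ sym) (≤-reflexive (cong proj₁ (sym eq))) (≤-reflexive (cong proj₂ (sym eq)))))

  labels : List (ℕ × ℕ)
  labels = map lab (upTo n)
  labels-unique : Unique labels
  labels-unique = injective⇒Unique-map (λ i∈ j∈ → lab-injective (∈-upTo⁻ i∈) (∈-upTo⁻ j∈)) (upTo⁺ n)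
  -- The n distinct labels lie among exactly n cells, so they fill the staircase.
  labels↭cells : labels ↭ cells m
  labels↭cells = pigeonhole labels-unique into (≤-reflexive (sym (trans (length-map lab (upTo n)) (length-upTo n))))
    where
    into : ∀ {x} → x ∈ labels → x ∈ cells m
    into x∈ with ∈-map⁻ lab x∈
    ... | i , i∈ , refl = ∈-cells⁺ (lab< (∈-upTo⁻ i∈))
  cover : ∀ {r c} → r + c < m → ∃ λ i → i < n × lab i ≡ (r , c)
  cover lt with ∈-map⁻ lab (∈-resp-↭ (↭-sym labels↭cells) (∈-cells⁺ lt))
  ... | i , i∈ , eq = i , ∈-upTo⁻ i∈ , sym eq
  -- `pos` inverts `lab`; the 0 is its default off the staircase.
  chosen = choose {D = λ (r , c) → r + c < m} (λ (r , c) → r + c <? m) {λ x i → i < n × lab i ≡ x} 0 (λ _ → cover)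
  pos : ℕ × ℕ → ℕ
  pos = proj₁ chosen
  pos< : ∀ {r c} → r + c < m → pos (r , c) < n
  pos< {r} {c} lt = proj₁ (proj₂ chosen (r , c) lt)
  lab-pos : ∀ {r c} → r + c < m → lab (pos (r , c)) ≡ (r , c)
  lab-pos {r} {c} lt = proj₂ (proj₂ chosen (r , c) lt)
  pos-lab : ∀ {i} → i < n → pos (lab i) ≡ i
  pos-lab i<n = lab-injective (pos< (lab< i<n)) i<n (lab-pos (lab< i<n))

  p₀ q₀ : ℕ → ℕ → ℕ
  p₀ r c = h₀ (pos (corow m r c , c))
  q₀ r c = suc (pos (r , c))

  module _ {r c r′ c′} (lt : r + c < m) (lt′ : r′ + c′ < m) (ne : (r , c) ≢ (r′ , c′)) (c≤c′ : c ≤ c′) where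
    private
      i = pos (r , c)
      j = pos (r′ , c′)
      i≢j : i ≢ j
      i≢j e = ne (trans (sym (lab-pos lt)) (trans (cong lab e) (lab-pos lt′)))
      a≤ : a₀ i ≤ a₀ j
      a≤ = subst₂ _≤_ (cong proj₂ (sym (lab-pos lt))) (cong proj₂ (sym (lab-pos lt′))) c≤c′
    cell-pos-mono : r ≤ r′ → i < j
    cell-pos-mono r≤r′ = pos-mono (pos< lt) (pos< lt′) i≢j
      (subst₂ _≤_ (cong proj₁ (sym (lab-pos lt))) (cong proj₁ (sym (lab-pos lt′))) r≤r′) a≤
    cell-val-mono : r′ ≤ r → h₀ i < h₀ j
    cell-val-mono r′≤r = val-mono (pos< lt) (pos< lt′) i≢j
      (subst₂ _≤_ (cong proj₁ (sym (lab-pos lt′))) (cong proj₁ (sym (lab-pos lt))) r′≤r) a≤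

  standard-q : Standard m q₀
  standard-q = record
    { perm = ↭-trans (map⁺ (uncurry q₀) (↭-sym labels↭cells)) (↭-reflexive (trans (sym (map-∘ (upTo n)))
        (map-cong-local (All.tabulate λ i∈ → cong suc (pos-lab (∈-upTo⁻ i∈))))))
    ; row< = λ {r} lt → s≤s (cell-pos-mono (<-trans (+-monoʳ-< r ≤-refl) lt) lt (λ ()) (n≤1+n _) ≤-refl)
    ; col< = λ lt → s≤s (cell-pos-mono (<-trans ≤-refl lt) lt (λ ()) ≤-refl (n≤1+n _))
    }

  reflect : ℕ × ℕ → ℕ × ℕ
  reflect (r , c) = corow m r c , c
  reflect-cells : map reflect (cells m) ↭ cells m
  reflect-cells = pigeonhole
    (injective⇒Unique-map (λ x∈ y∈ → reflect-injective (∈-cells⁻ x∈) (∈-cells⁻ y∈))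
      -- The cells do not repeat, since they rearrange the distinct labels.
      (Unique-resp-↭ labels↭cells labels-unique))
    into (≤-reflexive (sym (length-map reflect (cells m))))
    where
    reflect-involutive : ∀ {r c} → r + c < m → reflect (reflect (r , c)) ≡ (r , c)
    reflect-involutive {r} {c} lt = cong (_, c) (corow-involutive {m} {r} {c} lt)
    reflect-injective : ∀ {r c r′ c′} → r + c < m → r′ + c′ < m → reflect (r , c) ≡ reflect (r′ , c′) → (r , c) ≡ (r′ , c′)
    reflect-injective {r} {c} {r′} {c′} lt lt′ e =
      trans (sym (reflect-involutive {r} {c} lt)) (trans (cong reflect e) (reflect-involutive {r′} {c′} lt′))
    into : ∀ {x} → x ∈ map reflect (cells m) → x ∈ cells m
    into x∈ with ∈-map⁻ reflect x∈
    ... | (r , c) , y∈ , refl = ∈-cells⁺ (corow< {m} {r} {c} (∈-cells⁻ y∈))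

  p-col : ∀ {r c} → suc r + c < m → p₀ r c < p₀ (suc r) c
  p-col {r} {c} lt = cell-val-mono (corow< (<-trans ≤-refl lt)) (corow< lt)
    (λ e → 1+n≢n (trans (sym (corow-suc r c lt)) (cong proj₁ e))) ≤-refl
    (≤-trans (n≤1+n _) (≤-reflexive (sym (corow-suc r c lt))))
  diagonal-p : Diagonal m p₀
  diagonal-p {r} {c} lt = cell-val-mono (corow< lt) (corow< (subst (_< m) (sym (+-suc r c)) lt))
    (λ e → 1+n≢n (sym (cong proj₂ e))) (n≤1+n c) (≤-reflexive (sym (corow-diagonal m r c)))
  standard-p : Standard m p₀
  standard-p = record
    { perm = ↭-trans (↭-reflexive (map-∘ (cells m))) (↭-trans (map⁺ (h₀ ∘ pos) (↭-trans reflect-cells (↭-sym labels↭cells)))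
        (↭-trans (↭-reflexive (trans (sym (map-∘ (upTo n))) (trans
          (map-cong-local (All.tabulate λ i∈ → cong h₀ (pos-lab (∈-upTo⁻ i∈)))) (sym π≡₀)))) perm-π))
    -- A row step of P is a step down the column followed by a step up the diagonal.
    ; row< = λ {r} {c} lt → let lt′ = subst (_< m) (+-suc r c) lt in <-trans (p-col lt′) (diagonal-p lt′)
    ; col< = p-col
    }

-- From a pair to an avoiding permutation.

climb : ∀ {f : ℕ → ℕ} {x y} → (∀ {z} → z < y → f z ≤ f (suc z)) → x ≤ y → f x ≤ f y
climb {f} step x≤y = go step (≤⇒≤′ x≤y)
  where
  go : ∀ {x y} → (∀ {z} → z < y → f z ≤ f (suc z)) → x ≤′ y → f x ≤ f y
  go step ≤′-refl      = ≤-refl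
  go step (≤′-step le) = ≤-trans (go (λ z< → step (m<n⇒m<1+n z<)) le) (step ≤-refl)

descend : ∀ {f : ℕ → ℕ} {x y} → (∀ {z} → z < y → f (suc z) ≤ f z) → x ≤ y → f y ≤ f x
descend {f} step x≤y = go step (≤⇒≤′ x≤y)
  where
  go : ∀ {x y} → (∀ {z} → z < y → f (suc z) ≤ f z) → x ≤′ y → f y ≤ f x
  go step ≤′-refl      = ≤-refl
  go step (≤′-step le) = ≤-trans (step ≤-refl) (go (λ z< → step (m<n⇒m<1+n z<)) le)

-- Q gives each position its cell, and the reflected P its value. Once the coordinates are known to
-- be ranks, the staircase bound gives avoidance by `labels⇒avoids`.
decode : ∀ {m PQ} → GoodPair (suc m) PQ → ∃ λ π → AvoidingPerm (size m) (suc m) π × Encodes m π PQ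
decode {m} {P , Q} (sytP , sytQ , diag) with tableau-surjective m (proj₁ sytP) | tableau-surjective m (proj₁ sytQ)
... | p₀ , refl | q₀ , refl = map h₀ (upTo n) ,
  (perm-π , labels⇒avoids ra rb λ {i} i<n → subst (_< m) (+-comm (b₀ i) (a₀ i)) (lab< i<n)) , record
    { p = p₀ ; q = q₀ ; h = h₀ ; a = a₀ ; b = b₀ ; PQ≡ = refl ; π≡ = refl ; inc = ra ; dec = rb
    ; label< = lab< ; index = λ lt → let i , i<n , _ , e = cover lt in i , i<n , cong proj₁ e , cong proj₂ e
    ; q-label = q-lab ; p-label = λ _ → refl
    }
  where
  n = size m
  standard-p : Standard m p₀
  standard-p = isSYT⁻ sytP
  standard-q : Standard m q₀
  standard-q = isSYT⁻ sytQ
  diagonal-p : Diagonal m p₀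
  diagonal-p = diagonals⁻ {m} {p₀} diag

  entry-injective : ∀ {t} → Standard m t → ∀ {r c r′ c′} → r + c < m → r′ + c′ < m → t r c ≡ t r′ c′ → (r , c) ≡ (r′ , c′)
  entry-injective s lt lt′ = Unique-map-injective (isPerm⇒Unique (perm s)) (∈-cells⁺ lt) (∈-cells⁺ lt′)
  entry∈ : ∀ {t} → Standard m t → ∀ {r c} → r + c < m → t r c ∈ [ n ]
  entry∈ {t} s lt = ∈-resp-↭ (perm s) (∈-map⁺ (uncurry t) (∈-cells⁺ lt))

  locate : ∀ i → i < n → ∃ λ ((r , c) : ℕ × ℕ) → r + c < m × q₀ r c ≡ suc i
  locate i i<n with ∈-map⁻ (uncurry q₀) (∈-resp-↭ (↭-sym (perm standard-q)) (∈-[n]⁺ i<n))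
  ... | x , x∈ , e = x , ∈-cells⁻ x∈ , sym e
  located = choose (_<? n) (0 , 0) locate
  lab : ℕ → ℕ × ℕ
  lab = proj₁ located
  a₀ b₀ h₀ : ℕ → ℕ
  a₀ = proj₂ ∘ lab
  b₀ = proj₁ ∘ lab
  h₀ i = p₀ (corow m (b₀ i) (a₀ i)) (a₀ i)
  lab< : ∀ {i} → i < n → b₀ i + a₀ i < m
  lab< {i} i<n = proj₁ (proj₂ located i i<n)
  q-lab : ∀ {i} → i < n → q₀ (b₀ i) (a₀ i) ≡ suc i
  q-lab {i} i<n = proj₂ (proj₂ located i i<n)
  cover : ∀ {r c} → r + c < m → ∃ λ i → i < n × q₀ r c ≡ suc i × lab i ≡ (r , c)
  cover lt with ∈-[n]⁻ (entry∈ standard-q lt)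
  ... | i , i<n , e = i , i<n , e , entry-injective standard-q (lab< i<n) lt (trans (q-lab i<n) (sym e))

  -- The reflection of P, with `h₀ i` at the label of i. It falls down columns because P rises
  -- there, and rises along rows by the diagonals of P.
  v : ℕ → ℕ → ℕ
  v r c = p₀ (corow m r c) c
  v-col : ∀ {r c} → suc r + c < m → v (suc r) c < v r c
  v-col {r} {c} lt = subst (λ x → v (suc r) c < p₀ x c) (sym (corow-suc r c lt))
    (col< standard-p (subst (λ x → x + c < m) (corow-suc r c lt) (corow< {m} {r} {c} (<-trans ≤-refl lt))))
  v-row : ∀ {r c} → r + suc c < m → v r c < v r (suc c)
  v-row {r} {c} lt = subst₂ (λ x y → p₀ x c < p₀ y (suc c)) (sym (corow-suc r c lt′)) (corow-diagonal m r c)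
    (diagonal-p (subst (λ x → x + c < m) (corow-suc r c lt′) (corow< {m} {r} {c} (<-trans ≤-refl lt′))))
    where lt′ = subst (_< m) (+-suc r c) lt
  v-mono : ∀ {r c r′ c′} → r′ ≤ r → c ≤ c′ → r + c < m → r′ + c′ < m → v r c ≤ v r′ c′
  -- The path goes up column c and then right along row r′, inside the staircase.
  v-mono {r} {c} {r′} {c′} r′≤r c≤c′ lt lt′ = ≤-trans
    (descend {λ x → v x c} (λ z<r → <⇒≤ (v-col (≤-<-trans (+-monoˡ-≤ c z<r) lt))) r′≤r)
    (climb {v r′} (λ z<c′ → <⇒≤ (v-row (≤-<-trans (+-monoʳ-≤ r′ z<c′) lt′))) c≤c′)
  q-mono : ∀ {r c r′ c′} → r ≤ r′ → c ≤ c′ → r′ + c′ < m → q₀ r c ≤ q₀ r′ c′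
  q-mono {r} {c} {r′} {c′} r≤r′ c≤c′ lt = ≤-trans
    (climb {λ x → q₀ x c} (λ z<r′ → <⇒≤ (col< standard-q (≤-<-trans (+-mono-≤ z<r′ c≤c′) lt))) r≤r′)
    (climb {q₀ r′} (λ z<c′ → <⇒≤ (row< standard-q (≤-<-trans (+-monoʳ-≤ r′ z<c′) lt))) c≤c′)
  pos-mono : ∀ {i j} → i < n → j < n → b₀ i ≤ b₀ j → a₀ i ≤ a₀ j → i ≤ j
  pos-mono i<n j<n b≤ a≤ = s≤s⁻¹ (subst₂ _≤_ (q-lab i<n) (q-lab j<n) (q-mono b≤ a≤ (lab< j<n)))

  ra : IncRank n h₀ a₀
  ra = record { mono = mono′ ; tight = tight′ }
    where
    mono′ : ∀ {i j} → i < j → j < n → h₀ i < h₀ j → a₀ i < a₀ j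
    -- Suppose `a₀ j ≤ a₀ i`. Then `b₀ j ≤ b₀ i` gives j ≤ i through Q, and `b₀ i ≤ b₀ j` gives
    -- `h₀ j ≤ h₀ i` through `v`.
    mono′ {i} {j} i<j j<n lt = ≰⇒> λ a≥ → case-b a≥ (≤-total (b₀ j) (b₀ i))
      where
      i<n = <-trans i<j j<n
      case-b : a₀ j ≤ a₀ i → _ → ⊥
      case-b a≥ (inj₁ b≥) = <⇒≱ i<j (pos-mono j<n i<n b≥ a≥)
      case-b a≥ (inj₂ b≤) = <⇒≱ lt (v-mono b≤ a≥ (lab< j<n) (lab< i<n))
    tight′ : ∀ {j x} → j < n → a₀ j ≡ suc x → ∃ λ i → i < j × h₀ i < h₀ j × a₀ i ≡ x
    -- The witness is the position in the cell to the left: smaller in Q, hence earlier, and smaller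
    -- in `v`.
    tight′ {j} {x} j<n a≡ =
      let lt = subst (λ c → b₀ j + c < m) a≡ (lab< j<n)
          i , i<n , q≡ , lab≡ = cover (<-trans (+-monoʳ-< (b₀ j) ≤-refl) lt)
      in i ,
         s≤s⁻¹ (subst₂ _<_ q≡ (trans (cong (q₀ (b₀ j)) (sym a≡)) (q-lab j<n)) (row< standard-q lt)) ,
         subst₂ _<_ (cong (uncurry v) (sym lab≡)) (cong (v (b₀ j)) (sym a≡)) (v-row lt) ,
         cong proj₂ lab≡

  rb : DecRank n h₀ b₀
  rb = record { mono = mono′ ; tight = tight′ }
    where
    mono′ : ∀ {i j} → i < j → j < n → h₀ j < h₀ i → b₀ i < b₀ j
    mono′ {i} {j} i<j j<n lt = ≰⇒> λ b≥ → case-a b≥ (≤-total (a₀ j) (a₀ i))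
      where
      i<n = <-trans i<j j<n
      case-a : b₀ j ≤ b₀ i → _ → ⊥
      case-a b≥ (inj₁ a≥) = <⇒≱ i<j (pos-mono j<n i<n b≥ a≥)
      case-a b≥ (inj₂ a≤) = <⇒≱ lt (v-mono b≥ a≤ (lab< i<n) (lab< j<n))
    tight′ : ∀ {j x} → j < n → b₀ j ≡ suc x → ∃ λ i → i < j × h₀ j < h₀ i × b₀ i ≡ x
    -- The witness is the position in the cell above: earlier by Q, and larger in `v`.
    tight′ {j} {x} j<n b≡ =
      let lt = subst (λ r → r + a₀ j < m) b≡ (lab< j<n)
          i , i<n , q≡ , lab≡ = cover (<-trans ≤-refl lt)
      in i ,
         s≤s⁻¹ (subst₂ _<_ q≡ (trans (cong (λ r → q₀ r (a₀ j)) (sym b≡)) (q-lab j<n)) (col< standard-q lt)) ,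
         subst₂ _<_ (cong (λ r → v r (a₀ j)) (sym b≡)) (cong (uncurry v) (sym lab≡)) (v-col lt) ,
         cong proj₁ lab≡

  perm-π : IsPerm n (map h₀ (upTo n))
  perm-π = isPerm⁺ (injective⇒Unique-map (λ i∈ j∈ → h-injective (∈-upTo⁻ i∈) (∈-upTo⁻ j∈)) (upTo⁺ n))
    (All.map⁺ (All.tabulate λ i∈ → entry∈ standard-p (corow< (lab< (∈-upTo⁻ i∈)))))
    (trans (length-map h₀ (upTo n)) (length-upTo n))
    where
    h-injective : ∀ {i j} → i < n → j < n → h₀ i ≡ h₀ j → i ≡ j
    h-injective {i} {j} i<n j<n e = suc-injective (trans (sym (q-lab i<n)) (trans (cong₂ q₀ b≡ a≡) (q-lab j<n)))
      where
      same = entry-injective standard-p (corow< (lab< i<n)) (corow< (lab< j<n)) e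
      a≡ = cong proj₂ same
      b≡ : b₀ i ≡ b₀ j
      -- Equal entries of P give equal reflected cells; reflecting once more recovers the row.
      b≡ = trans (sym (corow-involutive (lab< i<n))) (trans (cong (uncurry (corow m)) same) (corow-involutive (lab< j<n)))

-- Comparing the two counts.

GoodPair-HasSize : ∀ {m N} → HasSize (AvoidingPerm (size m) (suc m)) N → HasSize (GoodPair (suc m)) N
GoodPair-HasSize {m} = HasSize-transfer (Encodes m) encode decode encodes-functional encodes-injective

theorem3 : (k : ℕ) → 2 ≤ k →
    ∃ λ N → HasSize (InRAvoid (k C 2) [ k ]) N × HasSize (GoodPair k) N
theorem3 (suc m) _ =
  -- With k = m + 1, both sets are counted through the avoiding permutations of the `size m`
  -- positions.
  let N , sized = AvoidingPerm-HasSize (size m) (suc m)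
  in N , subst (λ n → HasSize (InRAvoid n [ suc m ]) N) (size≡C m) (InRAvoid-HasSize sized) , GoodPair-HasSize sized
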